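{- For any two disjoint sets of (declared) procedures $P^+_1$ and $P^+_2$, abstracted individually into components $m_1$ and $m_2$, respectively, and with $P^+_1\cup P^+_2$ abstracted into component $m$, it holds that $m_1\times m_2=m$.
   Context: Language. Let $\mathcal{P}$ be a finite set of procedure names. Statements are given by $S::=\mathsf{skip}\mid x:=a\mid S_1;S_2\mid\mathsf{if}\ b\ \mathsf{then}\ S_1\ \mathsf{else}\ S_2\mid\mathsf{while}\ b\ \mathsf{do}\ S\mid\mathsf{call}\ p$ with $p\in\mathcal{P}$, $a$ arithmetic and $b$ Boolean expressions over the (global, integer-valued) program variables. Declared procedures have declarations $\mathsf{proc}\ p\ \mathsf{is}\ S_p$. A procedure $p$ calls $p'$ if $\mathsf{call}\ p'$ occurs in $S_p$. $\mathbf{State}$ is the set of mappings from program variables to integers. Environments. For $P\subseteq\mathcal{P}$, $\mathbf{Env}_P$ is the set of functions $P\to 2^{\mathbf{State}\times\mathbf{State}}$. For $\rho\in\mathbf{Env}_P$, $\rho'\in\mathbf{Env}_{P'}$, $\rho\sqsubseteq\rho'$ iff $P\subseteq P'$ and $\rho(p)\subseteq\rho'(p)$ for all $p\in P$. An interface is a pair $(P^-,P^+)$ of disjoint sets of procedure names (required: called but not declared; provided: declared). Denotations. For an interface $(P^-,P^+)$, $\rho^-\in\mathbf{Env}_{P^- }$ and $\rho^+\in\mathbf{Env}_{P^+}$, the denotation $[\![S]\!]^{\rho^+}_{\rho^- }\subseteq\mathbf{State}\times\mathbf{State}$ is the standard relational one, by induction on $S$: $\mathsf{skip}$ denotes the identity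 relation; $x:=a$ denotes $\{(s,s[x\mapsto a(s)])\}$, where $a(s)$ is the value of $a$ in $s$; $S_1;S_2$ denotes the relational composition (first $S_1$, then $S_2$); the conditional denotes the union of the denotation of $S_1$ restricted to initial states satisfying $b$ and that of $S_2$ restricted to initial states not satisfying $b$; $\mathsf{while}\ b\ \mathsf{do}\ S$ denotes the least relation $R$ such that $R=\{(s,s)\mid s\not\models b\}\cup\{(s,s'')\mid s\models b,\ \exists s'.\,(s,s')\in[\![S]\!]^{\rho^+}_{\rho^- },(s',s'')\in R\}$; and $[\![\mathsf{call}\ p]\!]^{\rho^+}_{\rho^- }$ is $\rho^-(p)$ if $p\in P^-$ and $\rho^+(p)$ if $p\in P^+$. Given $\rho^-\in\mathbf{Env}_{P^- }$, let $\xi:\mathbf{Env}_{P^+}\to\mathbf{Env}_{P^+}$ be $\xi(\rho^+)(p)=[\![S_p]\!]^{\rho^+}_{\rho^- }$ for $p\in P^+$; it is monotonic, and $\rho^+_0$ denotes its least fixed point. The standard denotation of $S$ in the context of $(P^-,P^+)$ and $\rho^-$ is $[\![S]\!]_{\rho^- }:=[\![S]\!]^{\rho^+_0}_{\rho^- }$. Components. A component $m$ with interface $(P^-_m,P^+_m)$ is a mapping $m:\mathbf{Env}_{P^-_m}\to\mathbf{Env}_{P^+_m}$ (monotonic w.r.t. $\sqsubseteq$). Components $m_1,m_2$ are composable iff $P^+_{m_1}\cap P^+_{m_2}=\varnothing$; then $m_1\times m_2$ has $P^+_{m_1\times m_2}=P^+_{m_1}\cup P^+_{m_2}$, $P^-_{m_1\times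 m_2}=(P^-_{m_1}\cup P^-_{m_2})\setminus(P^+_{m_1}\cup P^+_{m_2})$, and for $\rho^-\in\mathbf{Env}_{P^-_{m_1\times m_2}}$, $(m_1\times m_2)(\rho^-)$ is the least fixed point of $\chi^+:\mathbf{Env}_{P^+_{m_1\times m_2}}\to\mathbf{Env}_{P^+_{m_1\times m_2}}$ given by $\chi^+(\rho^+)(p)=m_1(\rho^-_{m_1})(p)$ for $p\in P^+_{m_1}$ and $m_2(\rho^-_{m_2})(p)$ for $p\in P^+_{m_2}$, where $\rho^-_{m_1}\in\mathbf{Env}_{P^-_{m_1}}$ is $\rho^-_{m_1}(p)=\rho^+(p)$ if $p\in P^-_{m_1}\cap P^+_{m_2}$ and $\rho^-(p)$ if $p\in P^-_{m_1}\setminus P^+_{m_2}$, and $\rho^-_{m_2}$ is defined symmetrically. Abstraction of procedure sets into components. A set $P^+$ of declared procedures, whose set of called procedures is $P'$, is abstracted into the component $m:\mathbf{Env}_{P^-_m}\to\mathbf{Env}_{P^+_m}$ with $P^+_m:=P^+$, $P^-_m:=P'\setminus P^+_m$, and $m(\rho^-_m)(p):=[\![S_p]\!]_{\rho^-_m}$ for all $\rho^-_m\in\mathbf{Env}_{P^-_m}$ and $p\in P^+_m$, the standard denotation being taken in the context of the interface $(P^-_m,P^+_m)$. -}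

module Defs where

open import Level using (0ℓ)
open import Data.Bool.Base using (Bool; T; if_then_else_)
open import Data.Fin.Base using (Fin; zero; suc)
open import Data.Fin.Subset
  using (Subset; _∈_; _∉_; _⊆_; _∪_; _∩_; _─_; ⋃; ⁅_⁆; Empty; outside; inside)
  renaming (⊥ to ∅)
open import Data.Fin.Subset.Properties
  using (_∈?_; x∈p∪q⁻; x∈p∩q⁺; x∈p∩q⁻; x∈p∧x∉q⇒x∈p─q; p─q⊆p; p⊆p∪q; q⊆p∪q)
open import Data.Integer.Base using (ℤ)
open import Data.List.Base using (tabulate)
open import Data.Nat.Base using (ℕ)
open import Data.Product.Base using (∃; _×_; _,_; proj₁)
open import Data.Sum.Base using (_⊎_; inj₁; inj₂; fromInj₂; [_,_]′)
open import Data.Vec.Base using (_∷_; here; there)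
open import Function.Base using (id; _∘_)
open import Relation.Binary.Construct.Never using (Never)
open import Relation.Binary.Core using (Rel; _⇒_)
open import Relation.Binary.Definitions using (DecidableEquality)
open import Relation.Binary.PropositionalEquality.Core using (_≡_)
open import Relation.Nullary.Decidable.Core using (Dec; yes; no; does)
open import Relation.Nullary.Negation.Core using (¬_; contradiction)

private variable
  n : ℕ

Disjoint : Subset n → Subset n → Set
Disjoint P Q = Empty (P ∩ Q)

x∈p─q⇒x∉q : ∀ (P Q : Subset n) {p} → p ∈ P ─ Q → p ∉ Q
x∈p─q⇒x∉q (_ ∷ P) (outside ∷ Q) (there i) (there j) = x∈p─q⇒x∉q P Q i j
x∈p─q⇒x∉q (_ ∷ P) (inside  ∷ Q) (there i) (there j) = x∈p─q⇒x∉q P Q i j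

─-disjoint : ∀ (P Q : Subset n) → Disjoint (P ─ Q) Q
─-disjoint P Q (_ , i) =
  let i₁ , i₂ = x∈p∩q⁻ (P ─ Q) Q i in x∈p─q⇒x∉q P Q i₁ i₂

∪-least : ∀ (P Q : Subset n) {R} → P ⊆ R → Q ⊆ R → P ∪ Q ⊆ R
∪-least P Q P⊆R Q⊆R i = [ P⊆R , Q⊆R ]′ (x∈p∪q⁻ P Q i)

⋃-tabulate⁺ : ∀ {k} (f : Fin k → Subset n) i → f i ⊆ ⋃ (tabulate f)
⋃-tabulate⁺ f zero    = p⊆p∪q (⋃ (tabulate (f ∘ suc)))
⋃-tabulate⁺ f (suc i) = q⊆p∪q (f zero) (⋃ (tabulate (f ∘ suc))) ∘ ⋃-tabulate⁺ (f ∘ suc) i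

record Interface (n : ℕ) : Set where
  field
    required : Subset n
    provided : Subset n
    disjoint : Disjoint required provided

open Interface public

Composable : Interface n → Interface n → Set
Composable I₁ I₂ = Disjoint (provided I₁) (provided I₂)

infixr 6 _⊗_

_⊗_ : Interface n → Interface n → Interface n
I₁ ⊗ I₂ = record
  { required = (required I₁ ∪ required I₂) ─ (provided I₁ ∪ provided I₂)
  ; provided = provided I₁ ∪ provided I₂
  ; disjoint = ─-disjoint (required I₁ ∪ required I₂) (provided I₁ ∪ provided I₂)
  }

-- The grammar of expressions is left open: any sets of expressions with
-- total evaluation functions will do.

record Language : Set₁ where
  field
    #procs  : ℕ
    Var     : Set
    _≟ᵛ_    : DecidableEquality Var
    AExp    : Set
    BExp    : Set

  Proc : Set
  Proc = Fin #procs

  ProcSet : Set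
  ProcSet = Subset #procs

  State : Set
  State = Var → ℤ

  field
    𝒜⟦_⟧ : AExp → State → ℤ
    ℬ⟦_⟧ : BExp → State → Bool

  _[_↦_] : State → Var → ℤ → State
  (s [ x ↦ v ]) y = if does (y ≟ᵛ x) then v else s y

  _⊨_ : State → BExp → Set
  s ⊨ b = T (ℬ⟦ b ⟧ s)

  data Stm : Set where
    skip  : Stm
    _:=_  : Var → AExp → Stm
    _⨾_   : Stm → Stm → Stm
    if    : BExp → Stm → Stm → Stm
    while : BExp → Stm → Stm
    call  : Proc → Stm

  calls : Stm → ProcSet
  calls skip         = ∅
  calls (x := a)     = ∅
  calls (S₁ ⨾ S₂)    = calls S₁ ∪ calls S₂
  calls (if b S₁ S₂) = calls S₁ ∪ calls S₂
  calls (while b S)  = calls S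
  calls (call p)     = ⁅ p ⁆

-- Irrelevant membership proofs make a family over `∀ p → .(p ∈ P)` a
-- function of the elements of P only.

record Program (L : Language) : Set where
  open Language L
  field
    declared : ProcSet
    body     : ∀ p → .(p ∈ declared) → Stm

module Semantics (L : Language) where
  open Language L

  private variable
    P Q R  : ProcSet
    I J K  : Interface #procs

  Env : ProcSet → Set₁
  Env P = ∀ p → .(p ∈ P) → Rel State 0ℓ

  infix 4 _⊑_ _≈_

  record _⊑_ (ρ : Env P) (ρ′ : Env Q) : Set where
    field
      dom  : P ⊆ Q
      incl : ∀ p .(p∈P : p ∈ P) → ρ p p∈P ⇒ ρ′ p (dom p∈P)

  open _⊑_ public

  -- Equality of environments is extensional: the same domain, and
  -- relations that contain the same pairs of states.

  _≈_ : Env P → Env Q → Set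
  ρ ≈ ρ′ = ρ ⊑ ρ′ × ρ′ ⊑ ρ

  IsLeastFixedPoint : (Env P → Env P) → Env P → Set₁
  IsLeastFixedPoint f ρ = f ρ ≈ ρ × (∀ σ → f σ ≈ σ → ρ ⊑ σ)

  -- The least R with R = {(s,s) | s ⊭ b} ∪ {(s,s″) | s ⊨ b, ∃ s′. s D s′ R s″}.

  data While (b : BExp) (D : Rel State 0ℓ) : Rel State 0ℓ where
    stop : ∀ {s} → ¬ (s ⊨ b) → While b D s s
    step : ∀ {s s″} → s ⊨ b → (∃ λ s′ → D s s′ × While b D s′ s″) → While b D s s″

  -- Names outside P ∪ Q get the empty relation.  This case does not arise
  -- in the interface of an abstraction: see calls⊆interface.

  callee : Env P → Env Q → ∀ {p} → Dec (p ∈ P) → Dec (p ∈ Q) → Rel State 0ℓ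
  callee ρ⁻ ρ⁺ (yes p∈P) _         = ρ⁻ _ p∈P
  callee ρ⁻ ρ⁺ (no _)    (yes p∈Q) = ρ⁺ _ p∈Q
  callee ρ⁻ ρ⁺ (no _)    (no _)    = Never

  ⟦_⟧ : Stm → Env P → Env Q → Rel State 0ℓ
  ⟦ skip ⟧       ρ⁻ ρ⁺ s s′ = s′ ≡ s
  ⟦ x := a ⟧     ρ⁻ ρ⁺ s s′ = s′ ≡ s [ x ↦ 𝒜⟦ a ⟧ s ]
  ⟦ S₁ ⨾ S₂ ⟧    ρ⁻ ρ⁺ s s′ = ∃ λ t → ⟦ S₁ ⟧ ρ⁻ ρ⁺ s t × ⟦ S₂ ⟧ ρ⁻ ρ⁺ t s′
  ⟦ if b S₁ S₂ ⟧ ρ⁻ ρ⁺ s s′ =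
    (s ⊨ b × ⟦ S₁ ⟧ ρ⁻ ρ⁺ s s′) ⊎ (¬ (s ⊨ b) × ⟦ S₂ ⟧ ρ⁻ ρ⁺ s s′)
  ⟦ while b S ⟧  ρ⁻ ρ⁺ s s′ = While b (⟦ S ⟧ ρ⁻ ρ⁺) s s′
  ⟦_⟧ {P} {Q} (call p) ρ⁻ ρ⁺ s s′ = callee ρ⁻ ρ⁺ (p ∈? P) (p ∈? Q) s s′

  record Component (I : Interface #procs) : Set₁ where
    field
      run  : Env (required I) → Env (provided I)
      mono : ∀ {ρ σ} → ρ ⊑ σ → run ρ ⊑ run σ

  open Component public

  infix 4 _≅_

  record _≅_ (m : Component I) (m′ : Component J) : Set₁ where
    field
      required≡ : required I ≡ required J
      provided≡ : provided I ≡ provided J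
      run≈      : ∀ {ρ : Env (required I)} {ρ′ : Env (required J)} →
                  ρ ≈ ρ′ → run m ρ ≈ run m′ ρ′

  -- The environment for a component with interface I that is composed
  -- with one with interface J, given environments ρ⁻ and ρ⁺ for the
  -- composite.

  inputs : ∀ (I J : Interface #procs) →
           .(required I ─ provided J ⊆ Q) → .(provided J ⊆ R) →
           Env Q → Env R → Env (required I)
  inputs I J ⊆Q ⊆R ρ⁻ ρ⁺ p p∈I with p ∈? provided J
  ... | yes p∈J = ρ⁺ p (⊆R p∈J)
  ... | no  p∉J = ρ⁻ p (⊆Q (x∈p∧x∉q⇒x∈p─q p∈I p∉J))

  private
    required₁ : ∀ (I J : Interface #procs) →
                required I ─ provided J ⊆ required (I ⊗ J)
    required₁ I J i = x∈p∧x∉q⇒x∈p─q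
      (p⊆p∪q (required J) i∈I)
      (λ k → [ (λ i∈I⁺ → disjoint I (_ , x∈p∩q⁺ (i∈I , i∈I⁺)))
             , x∈p─q⇒x∉q (required I) (provided J) i
             ]′ (x∈p∪q⁻ (provided I) (provided J) k))
      where i∈I = p─q⊆p (required I) (provided J) i

    required₂ : ∀ (I J : Interface #procs) →
                required J ─ provided I ⊆ required (I ⊗ J)
    required₂ I J i = x∈p∧x∉q⇒x∈p─q
      (q⊆p∪q (required I) (required J) j∈J)
      (λ k → [ x∈p─q⇒x∉q (required J) (provided I) i
             , (λ i∈J⁺ → disjoint J (_ , x∈p∩q⁺ (j∈J , i∈J⁺)))
             ]′ (x∈p∪q⁻ (provided I) (provided J) k))
      where j∈J = p─q⊆p (required J) (provided I) i

  χ : Component I → Component J →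
      Env (required (I ⊗ J)) → Env (provided (I ⊗ J)) → Env (provided (I ⊗ J))
  χ {I} {J} m₁ m₂ ρ⁻ ρ⁺ p p∈∪ with p ∈? provided I
  ... | yes p∈I = run m₁
        (inputs I J (required₁ I J) (q⊆p∪q (provided I) (provided J)) ρ⁻ ρ⁺) p p∈I
  ... | no  p∉I = run m₂
        (inputs J I (required₂ I J) (p⊆p∪q (provided J)) ρ⁻ ρ⁺) p
        (fromInj₂ (λ p∈I → contradiction p∈I p∉I) (x∈p∪q⁻ (provided I) (provided J) p∈∪))

  -- The least fixed point of χ for arbitrary monotone m₁ and m₂ is not
  -- definable at this universe level without impredicativity, so the
  -- product is specified rather than computed.  It is unique up to _≅_.

  record IsProduct (m₁ : Component I) (m₂ : Component J)
                   (m : Component (I ⊗ J)) : Set₁ where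
    field
      composable : Composable I J
      run-lfp    : ∀ ρ⁻ → IsLeastFixedPoint (χ m₁ m₂ ρ⁻) (run m ρ⁻)

  -- m₁ × m₂ = m: the product exists, and it equals m.

  record _×_≐_ (m₁ : Component I) (m₂ : Component J)
                (m : Component K) : Set₁ where
    field
      exists : ∃ λ m× → IsProduct m₁ m₂ m×
      equal  : ∀ m× → IsProduct m₁ m₂ m× → m× ≅ m

  module Abstraction (prog : Program L) where
    open Program prog

    calledFrom : (P : ProcSet) → .(P ⊆ declared) → Proc → ProcSet
    calledFrom P P⊆D p with p ∈? P
    ... | yes p∈P = calls (body p (P⊆D p∈P))
    ... | no  _   = ∅

    called : (P : ProcSet) → .(P ⊆ declared) → ProcSet
    called P P⊆D = ⋃ (tabulate (calledFrom P P⊆D))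

    interface : (P : ProcSet) → .(P ⊆ declared) → Interface #procs
    interface P P⊆D = record
      { required = called P P⊆D ─ P
      ; provided = P
      ; disjoint = ─-disjoint (called P P⊆D) P
      }

    calls⊆called : ∀ P .(P⊆D : P ⊆ declared) {p} (p∈P : p ∈ P) →
                   calls (body p (P⊆D p∈P)) ⊆ called P P⊆D
    calls⊆called P P⊆D {p} p∈P = ⋃-tabulate⁺ (calledFrom P P⊆D) p ∘ calls⊆calledFrom
      where
      calls⊆calledFrom : calls (body p (P⊆D p∈P)) ⊆ calledFrom P P⊆D p
      calls⊆calledFrom i with p ∈? P
      ... | yes _   = i
      ... | no  p∉P = contradiction p∈P p∉P

    calls⊆interface : ∀ P .(P⊆D : P ⊆ declared) {p} (p∈P : p ∈ P) →
                      let I = interface P P⊆D in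
                      calls (body p (P⊆D p∈P)) ⊆ required I ∪ provided I
    calls⊆interface P P⊆D p∈P {q} i with q ∈? P
    ... | yes q∈P = q⊆p∪q (called P P⊆D ─ P) P q∈P
    ... | no  q∉P = p⊆p∪q P (x∈p∧x∉q⇒x∈p─q (calls⊆called P P⊆D p∈P i) q∉P)

    module _ (P : ProcSet) .(P⊆D : P ⊆ declared) where
      private
        P⁻ : ProcSet
        P⁻ = required (interface P P⊆D)

      ξ : Env P⁻ → Env P → Env P
      ξ ρ⁻ ρ⁺ p p∈P = ⟦ body p (P⊆D p∈P) ⟧ ρ⁻ ρ⁺

      data ρ₀ (ρ⁻ : Env P⁻) : Env P where
        fix : ∀ {p} .{p∈P : p ∈ P} {s s′} →
                 ξ ρ⁻ (ρ₀ ρ⁻) p p∈P s s′ → ρ₀ ρ⁻ p p∈P s s′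

      standard : Stm → Env P⁻ → Rel State 0ℓ
      standard S ρ⁻ = ⟦ S ⟧ ρ⁻ (ρ₀ ρ⁻)

      module _ {ρ⁻ σ⁻ : Env P⁻} {σ : Env P}
               (ρ⁻⊑σ⁻ : ρ⁻ ⊑ σ⁻) (ξσ⊑σ : ξ σ⁻ σ ⊑ σ) where

        ρ₀-fold : ∀ p .(p∈P : p ∈ P) → ρ₀ ρ⁻ p p∈P ⇒ σ p p∈P

        standard-fold : ∀ S → standard S ρ⁻ ⇒ ⟦ S ⟧ σ⁻ σ

        While-fold : ∀ b S → While b (standard S ρ⁻) ⇒ While b (⟦ S ⟧ σ⁻ σ)

        callee-fold : ∀ {p} (d : Dec (p ∈ P⁻)) (e : Dec (p ∈ P)) →
                      callee ρ⁻ (ρ₀ ρ⁻) d e ⇒ callee σ⁻ σ d e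

        ρ₀-fold p p∈P (fix r) =
          incl ξσ⊑σ p p∈P (standard-fold (body p (P⊆D p∈P)) r)

        standard-fold skip         r              = r
        standard-fold (x := a)     r              = r
        standard-fold (S₁ ⨾ S₂)    (s , r₁ , r₂)  =
          s , standard-fold S₁ r₁ , standard-fold S₂ r₂
        standard-fold (if b S₁ S₂) (inj₁ (t , r)) = inj₁ (t , standard-fold S₁ r)
        standard-fold (if b S₁ S₂) (inj₂ (f , r)) = inj₂ (f , standard-fold S₂ r)
        standard-fold (while b S)  r              = While-fold b S r
        standard-fold (call p)     r              = callee-fold (p ∈? P⁻) (p ∈? P) r

        While-fold b S (stop f)              = stop f
        While-fold b S (step t (s , r , rs)) =
          step t (s , standard-fold S r , While-fold b S rs)

        callee-fold (yes p∈P⁻) _         r = incl ρ⁻⊑σ⁻ _ p∈P⁻ r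
        callee-fold (no _)     (yes p∈P) r = ρ₀-fold _ p∈P r

      ρ₀-fixed : ∀ ρ⁻ → ξ ρ⁻ (ρ₀ ρ⁻) ≈ ρ₀ ρ⁻
      ρ₀-fixed ρ⁻ =
        record { dom = id ; incl = λ _ _ → fix } ,
        record { dom = id ; incl = λ { _ _ (fix r) → r } }

      ρ₀-isLeastFixedPoint : ∀ ρ⁻ → IsLeastFixedPoint (ξ ρ⁻) (ρ₀ ρ⁻)
      ρ₀-isLeastFixedPoint ρ⁻ =
        ρ₀-fixed ρ⁻ ,
        λ σ ξσ≈σ → record
          { dom  = id
          ; incl = ρ₀-fold (record { dom = id ; incl = λ _ _ r → r }) (proj₁ ξσ≈σ)
          }

      abstraction : Component (interface P P⊆D)
      abstraction = record
        { run  = λ ρ⁻ p p∈P → standard (body p (P⊆D p∈P)) ρ⁻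
        ; mono = λ {_} {σ⁻} ρ⁻⊑σ⁻ → record
            { dom  = id
            ; incl = λ p p∈P →
                standard-fold ρ⁻⊑σ⁻ (proj₁ (ρ₀-fixed σ⁻)) (body p (P⊆D p∈P))
            }
        }

{-# OPTIONS --safe #-}

-- Bekić's principle.  Fix the environment of the required procedures, and
-- write χ for the operator of the product and ξ for that of the union.
-- Every pre-fixed point of ξ is one of χ, since each component takes a least
-- fixed point over its own procedures only.  Conversely, if χ σ ⊑ σ, then
-- χ σ is a pre-fixed point of ξ: a call inside a component unfolds its local
-- fixed point, and a call across components goes from χ σ to σ.  Hence the
-- denotation of the union is the least fixed point of χ.

module Submission where

open import Defs
open import Data.Fin.Base using (Fin; zero; suc)
open import Data.Fin.Subset using (Subset; _∈_; _∉_; _⊆_; _∪_; _─_; ⋃)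
open import Data.Fin.Subset.Properties
  using (_∈?_; ∉⊥; x∈⁅x⁆; x∈p∪q⁻; x∈p∪q⁺; x∈p∩q⁺; x∈p∧x∉q⇒x∈p─q; p─q⊆p;
         p⊆p∪q; q⊆p∪q; ⊆-antisym)
open import Data.List.Base using (tabulate)
open import Data.Nat.Base using (ℕ)
open import Data.Product.Base using (∃; ∃-syntax; _,_; proj₁)
open import Data.Sum.Base using (_⊎_; inj₁; inj₂; [_,_]′; swap)
open import Function.Base using (id; _∘_)
open import Level using (0ℓ)
open import Relation.Binary.Core using (Rel; _⇒_)
open import Relation.Binary.PropositionalEquality.Core
  using (_≡_; refl; sym; trans)
open import Relation.Nullary.Decidable.Core using (yes; no; recompute)
open import Relation.Nullary.Negation.Core using (contradiction)

private variable
  n : ℕ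

-- Finite subsets and interfaces.

⋃-tabulate⁻ : ∀ {k} (f : Fin k → Subset n) {x} → x ∈ ⋃ (tabulate f) → ∃[ i ] x ∈ f i
⋃-tabulate⁻ {k = ℕ.zero}  f x∈ = contradiction x∈ ∉⊥
⋃-tabulate⁻ {k = ℕ.suc k} f x∈ with x∈p∪q⁻ (f zero) (⋃ (tabulate (f ∘ suc))) x∈
... | inj₁ x∈f0 = zero , x∈f0
... | inj₂ x∈fs = let i , x∈fi = ⋃-tabulate⁻ (f ∘ suc) x∈fs in suc i , x∈fi

-- Both hypotheses concern the single element `x` rather than whole subsets, so their proofs may use
-- that `x` lies in `P ─ Q`.
─-mono-∉ : ∀ (P Q : Subset n) {A B : Subset n} {x} →
           (x ∈ P → x ∈ A) → (x ∉ Q → x ∉ B) → x ∈ P ─ Q → x ∈ A ─ B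
─-mono-∉ P Q P⇒A ∉Q⇒∉B x∈ =
  x∈p∧x∉q⇒x∈p─q (P⇒A (p─q⊆p P Q x∈)) (∉Q⇒∉B (x∈p─q⇒x∉q P Q x∈))

module _ (I J : Interface n) where

  -- The disjointness inside `I` keeps a required name out of `provided I`, and the difference keeps
  -- it out of `provided J`. The bound on `B` is a sum of memberships so that either order of the
  -- union fits.
  required─provided⊆ : ∀ {A B : Subset n} → required I ⊆ A →
    (∀ {x} → x ∈ B → x ∈ provided I ⊎ x ∈ provided J) →
    required I ─ provided J ⊆ A ─ B
  required─provided⊆ I⊆A B⊆ x∈ =
    x∈p∧x∉q⇒x∈p─q (I⊆A x∈I)
      ([ (λ x∈I⁺ → disjoint I (_ , x∈p∩q⁺ (x∈I , x∈I⁺)))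
       , x∈p─q⇒x∉q (required I) (provided J) x∈
       ]′ ∘ B⊆)
    where x∈I = p─q⊆p (required I) (provided J) x∈

  -- `χ` passes private proofs of this inclusion to `inputs`. As `inputs` takes them irrelevantly,
  -- this proof yields the same environment.
  required-⊗ˡ : required I ─ provided J ⊆ required (I ⊗ J)
  required-⊗ˡ = required─provided⊆
    (p⊆p∪q (required J)) (x∈p∪q⁻ (provided I) (provided J))

required-⊗ʳ : ∀ (I J : Interface n) → required J ─ provided I ⊆ required (I ⊗ J)
required-⊗ʳ I J = required─provided⊆ J I
  (q⊆p∪q (required I) (required J)) (swap ∘ x∈p∪q⁻ (provided I) (provided J))

module _ {L : Language} where
  open Language L
  open Semantics L

  private variable
    P Q R P′ Q′ : ProcSet
    I J : Interface #procs

  -- Environments and the lookup of called names.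

  ≡⇒⇒ : ∀ {D E : Rel State 0ℓ} → D ≡ E → D ⇒ E
  ≡⇒⇒ refl r = r

  ⊑-refl : {ρ : Env P} → ρ ⊑ ρ
  ⊑-refl = record { dom = id ; incl = λ _ _ → id }

  ⊑-trans : {ρ : Env P} {σ : Env Q} {τ : Env R} → ρ ⊑ σ → σ ⊑ τ → ρ ⊑ τ
  ⊑-trans ρ⊑σ σ⊑τ = record
    { dom  = dom σ⊑τ ∘ dom ρ⊑σ
    ; incl = λ p p∈P → incl σ⊑τ p (dom ρ⊑σ p∈P) ∘ incl ρ⊑σ p p∈P
    }

  restrict : .(P ⊆ Q) → Env Q → Env P
  restrict P⊆Q ρ p p∈P = ρ p (P⊆Q p∈P)

  restrict-≈ : (P⊆Q : P ⊆ Q) → Q ⊆ P → (ρ : Env Q) → restrict P⊆Q ρ ≈ ρ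
  restrict-≈ P⊆Q Q⊆P ρ =
    record { dom = P⊆Q ; incl = λ _ _ → id } ,
    record { dom = Q⊆P ; incl = λ _ _ → id }

  lfp-unique : ∀ {f : Env P → Env P} {ρ σ} →
               IsLeastFixedPoint f ρ → IsLeastFixedPoint f σ → ρ ≈ σ
  lfp-unique (fρ≈ρ , ρ-least) (fσ≈σ , σ-least) = ρ-least _ fσ≈σ , σ-least _ fρ≈ρ

  -- This is the denotation of `call q`. Denotations depend on the two environments only through it,
  -- so it serves to compare environments over different domains.
  lookup : Env P → Env Q → Proc → Rel State 0ℓ
  lookup {P} {Q} ρ⁻ ρ⁺ q = callee ρ⁻ ρ⁺ (q ∈? P) (q ∈? Q)

  lookup-∈⁻ : ∀ (ρ⁻ : Env P) (ρ⁺ : Env Q) {q} (q∈P : q ∈ P) →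
              lookup ρ⁻ ρ⁺ q ≡ ρ⁻ q q∈P
  lookup-∈⁻ {P} ρ⁻ ρ⁺ {q} q∈P with q ∈? P
  ... | yes _  = refl
  ... | no q∉P = contradiction q∈P q∉P

  lookup-∈⁺ : ∀ (ρ⁻ : Env P) (ρ⁺ : Env Q) {q} → q ∉ P → (q∈Q : q ∈ Q) →
              lookup ρ⁻ ρ⁺ q ≡ ρ⁺ q q∈Q
  lookup-∈⁺ {P} {Q} ρ⁻ ρ⁺ {q} q∉P q∈Q with q ∈? P | q ∈? Q
  ... | yes q∈P | _      = contradiction q∈P q∉P
  ... | no _    | yes _  = refl
  ... | no _    | no q∉Q = contradiction q∈Q q∉Q

  lookup-mono⁺ : ∀ (ρ⁻ : Env P) {ρ⁺ σ⁺ : Env Q} → ρ⁺ ⊑ σ⁺ →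
                 ∀ q → lookup ρ⁻ ρ⁺ q ⇒ lookup ρ⁻ σ⁺ q
  lookup-mono⁺ {P} {Q} ρ⁻ ρ⁺⊑σ⁺ q r with q ∈? P | q ∈? Q
  ... | yes _ | _       = r
  ... | no _  | yes q∈Q = incl ρ⁺⊑σ⁺ q q∈Q r

  -- Monotonicity of denotations.

  While-mono : ∀ {b} {D E : Rel State 0ℓ} → D ⇒ E → While b D ⇒ While b E
  While-mono D⇒E (stop f)              = stop f
  While-mono D⇒E (step t (s , r , rs)) = step t (s , D⇒E r , While-mono D⇒E rs)

  module _ {ρ⁻ : Env P} {ρ⁺ : Env Q} {σ⁻ : Env P′} {σ⁺ : Env Q′} where

    -- The four domains are unrelated because the same body is read in the interface of its
    -- component and in that of the union, where a required name may become a provided one.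
    ⟦⟧-mono : ∀ S → (∀ {q} → q ∈ calls S → lookup ρ⁻ ρ⁺ q ⇒ lookup σ⁻ σ⁺ q) →
              ⟦ S ⟧ ρ⁻ ρ⁺ ⇒ ⟦ S ⟧ σ⁻ σ⁺
    ⟦⟧-mono skip         h r              = r
    ⟦⟧-mono (x := a)     h r              = r
    ⟦⟧-mono (S₁ ⨾ S₂)    h (s , r₁ , r₂)  =
      s , ⟦⟧-mono S₁ (h ∘ p⊆p∪q (calls S₂)) r₁
        , ⟦⟧-mono S₂ (h ∘ q⊆p∪q (calls S₁) (calls S₂)) r₂
    ⟦⟧-mono (if b S₁ S₂) h (inj₁ (t , r)) =
      inj₁ (t , ⟦⟧-mono S₁ (h ∘ p⊆p∪q (calls S₂)) r)
    ⟦⟧-mono (if b S₁ S₂) h (inj₂ (f , r)) =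
      inj₂ (f , ⟦⟧-mono S₂ (h ∘ q⊆p∪q (calls S₁) (calls S₂)) r)
    ⟦⟧-mono (while b S)  h r              = While-mono (⟦⟧-mono S h) r
    ⟦⟧-mono (call p)     h r              = h (x∈⁅x⁆ p) r

  -- The operator of the product.

  module _ (m₁ : Component I) (m₂ : Component J) where

    χ-∈ˡ : ∀ ρ⁻ ρ⁺ {p} .(p∈∪ : p ∈ provided I ∪ provided J) (p∈I : p ∈ provided I) →
           χ m₁ m₂ ρ⁻ ρ⁺ p p∈∪ ≡
           run m₁ (inputs I J (required-⊗ˡ I J) (q⊆p∪q (provided I) (provided J)) ρ⁻ ρ⁺) p p∈I
    χ-∈ˡ ρ⁻ ρ⁺ {p} p∈∪ p∈I with p ∈? provided I
    ... | yes _  = refl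
    ... | no p∉I = contradiction p∈I p∉I

    -- `χ` tests `provided I` first; disjointness of the provided sets sends `p` to the second
    -- branch.
    χ-∈ʳ : Composable I J →
           ∀ ρ⁻ ρ⁺ {p} .(p∈∪ : p ∈ provided I ∪ provided J) (p∈J : p ∈ provided J) →
           χ m₁ m₂ ρ⁻ ρ⁺ p p∈∪ ≡
           run m₂ (inputs J I (required-⊗ʳ I J) (p⊆p∪q (provided J)) ρ⁻ ρ⁺) p p∈J
    χ-∈ʳ I#J ρ⁻ ρ⁺ {p} p∈∪ p∈J with p ∈? provided I
    ... | yes p∈I = contradiction (p , x∈p∩q⁺ (p∈I , p∈J)) I#J
    ... | no _    = refl

  inputs≡lookup : ∀ (I J K : Interface #procs)
    .(⊆Q : required I ─ provided J ⊆ Q) (⊆K⁻ : required I ─ provided J ⊆ required K)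
    (⊆K⁺ : provided J ⊆ provided K) .(K⁻⊆Q : required K ⊆ Q) →
    ∀ (ρ⁻ : Env Q) (ρ⁺ : Env (provided K)) p (p∈I : p ∈ required I) →
    inputs I J ⊆Q ⊆K⁺ ρ⁻ ρ⁺ p p∈I ≡ lookup (restrict K⁻⊆Q ρ⁻) ρ⁺ p
  inputs≡lookup I J K ⊆Q ⊆K⁻ ⊆K⁺ K⁻⊆Q ρ⁻ ρ⁺ p p∈I with p ∈? provided J
  ... | yes p∈J = sym (lookup-∈⁺ (restrict K⁻⊆Q ρ⁻) ρ⁺
                        (λ p∈K⁻ → disjoint K (p , x∈p∩q⁺ (p∈K⁻ , ⊆K⁺ p∈J))) (⊆K⁺ p∈J))
  ... | no  p∉J = sym (lookup-∈⁻ (restrict K⁻⊆Q ρ⁻) ρ⁺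
                        (⊆K⁻ (x∈p∧x∉q⇒x∈p─q p∈I p∉J)))

  module _ (prog : Program L) where
    open Program prog
    open Abstraction prog

    -- Names called from a set of procedures.

    calledFrom⁻ : ∀ P .(P⊆D : P ⊆ declared) p {q} → q ∈ calledFrom P P⊆D p →
                  ∃ λ (p∈P : p ∈ P) → q ∈ calls (body p (P⊆D p∈P))
    calledFrom⁻ P P⊆D p q∈ with p ∈? P
    ... | yes p∈P = p∈P , q∈
    ... | no  _   = contradiction q∈ ∉⊥

    called⁻ : ∀ P .(P⊆D : P ⊆ declared) {q} → q ∈ called P P⊆D →
              ∃ λ p → ∃ λ (p∈P : p ∈ P) → q ∈ calls (body p (P⊆D p∈P))
    called⁻ P P⊆D q∈ =
      let p , q∈p = ⋃-tabulate⁻ (calledFrom P P⊆D) q∈ in p , calledFrom⁻ P P⊆D p q∈p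

    called-mono : .(P⊆D : P ⊆ declared) .(Q⊆D : Q ⊆ declared) → P ⊆ Q →
                  called P P⊆D ⊆ called Q Q⊆D
    called-mono {P} {Q} P⊆D Q⊆D P⊆Q q∈ =
      let p , p∈P , q∈p = called⁻ P P⊆D q∈ in calls⊆called Q Q⊆D (P⊆Q p∈P) q∈p

    called-∪⁻ : ∀ P Q .(P⊆D : P ⊆ declared) .(Q⊆D : Q ⊆ declared)
                .(P∪Q⊆D : P ∪ Q ⊆ declared) →
                called (P ∪ Q) P∪Q⊆D ⊆ called P P⊆D ∪ called Q Q⊆D
    called-∪⁻ P Q P⊆D Q⊆D P∪Q⊆D q∈ with called⁻ (P ∪ Q) P∪Q⊆D q∈
    ... | p , p∈∪ , q∈p with x∈p∪q⁻ P Q p∈∪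
    ...   | inj₁ p∈P = p⊆p∪q _ (calls⊆called P P⊆D p∈P q∈p)
    ...   | inj₂ p∈Q = q⊆p∪q _ _ (calls⊆called Q Q⊆D p∈Q q∈p)

    -- One component within a larger set of procedures.

    module Part (P U : ProcSet) .(P⊆D : P ⊆ declared) .(U⊆D : U ⊆ declared) (P⊆U : P ⊆ U)
                (ρ⁻ : Env (required (interface U U⊆D))) (ρ⁺ : Env U)
                (ι : Env (required (interface P P⊆D)))
                (ι≡ : ∀ q (q∈ : q ∈ required (interface P P⊆D)) → ι q q∈ ≡ lookup ρ⁻ ρ⁺ q)
                where

      lookup-U : ∀ (σ : Env U) {q} (q∈P : q ∈ P) → lookup ρ⁻ σ q ≡ σ q (P⊆U q∈P)
      lookup-U σ q∈P = lookup-∈⁺ ρ⁻ σ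
        (λ q∈U⁻ → x∈p─q⇒x∉q (called U U⊆D) U q∈U⁻ (P⊆U q∈P)) (P⊆U q∈P)

      lookup-P : ∀ (σ : Env P) {q} (q∈P : q ∈ P) → lookup ι σ q ≡ σ q q∈P
      lookup-P σ q∈P = lookup-∈⁺ ι σ (λ q∈P⁻ → x∈p─q⇒x∉q (called P P⊆D) P q∈P⁻ q∈P) q∈P

      -- Calls from bodies in `P` find the same relations under `ι` and the restriction of `ρ⁺` as
      -- in `U`. The restriction is therefore a pre-fixed point of the local operator, and the local
      -- least fixed point lies below it.
      part⊑ : ξ U U⊆D ρ⁻ ρ⁺ ⊑ ρ⁺ → run (abstraction P P⊆D) ι ⊑ ρ⁺
      part⊑ ξρ⁺⊑ρ⁺ = record
        { dom  = P⊆U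
        -- `run` is one body over the local fixed point: `standard-fold` replaces that fixed point
        -- by the restriction, and pre-fixedness absorbs the outer body.
        ; incl = λ p p∈P r → body-incl p p∈P
            (standard-fold P P⊆D ⊑-refl (record { dom = id ; incl = body-incl })
              (body p (P⊆D p∈P)) r)
        }
        where
        lookup-incl : ∀ {q} → q ∈ required (interface P P⊆D) ⊎ q ∈ P →
                      lookup ι (restrict P⊆U ρ⁺) q ⇒ lookup ρ⁻ ρ⁺ q
        lookup-incl (inj₁ q∈P⁻) = ≡⇒⇒ (trans (lookup-∈⁻ ι _ q∈P⁻) (ι≡ _ q∈P⁻))
        lookup-incl (inj₂ q∈P)  = ≡⇒⇒ (trans (lookup-P _ q∈P) (sym (lookup-U ρ⁺ q∈P)))

        body-incl : ∀ p .(p∈P : p ∈ P) →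
                    ⟦ body p (P⊆D p∈P) ⟧ ι (restrict P⊆U ρ⁺) ⇒ ρ⁺ p (P⊆U p∈P)
        body-incl p p∈P r = incl ξρ⁺⊑ρ⁺ p (P⊆U p∈P)
          (⟦⟧-mono (body p (P⊆D p∈P))
            (lookup-incl ∘ x∈p∪q⁻ _ P ∘ calls⊆interface P P⊆D (recompute (p ∈? P) p∈P)) r)

      -- In the application, `σ` is the image of `ρ⁺` under `χ`. A call to a required name of `P`
      -- passes from `σ` to `ρ⁺`, where `ι` gives the same relation; a call within `P` passes to
      -- `run`, which `fix` folds into the local fixed point.
      ⊑part : ∀ {σ : Env U} → σ ⊑ ρ⁺ →
              (∀ p (p∈P : p ∈ P) → σ p (P⊆U p∈P) ⇒ run (abstraction P P⊆D) ι p p∈P) →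
              ∀ p (p∈P : p ∈ P) →
              ξ U U⊆D ρ⁻ σ p (P⊆U p∈P) ⇒ run (abstraction P P⊆D) ι p p∈P
      ⊑part {σ} σ⊑ρ⁺ σ⇒run p p∈P =
        ⟦⟧-mono (body p (P⊆D p∈P)) (lookup-incl ∘ x∈p∪q⁻ _ P ∘ calls⊆interface P P⊆D p∈P)
        where
        lookup-incl : ∀ {q} → q ∈ required (interface P P⊆D) ⊎ q ∈ P →
                      lookup ρ⁻ σ q ⇒ lookup ι (ρ₀ P P⊆D ι) q
        lookup-incl {q} (inj₁ q∈P⁻) =
          ≡⇒⇒ (sym (trans (lookup-∈⁻ ι _ q∈P⁻) (ι≡ q q∈P⁻))) ∘ lookup-mono⁺ ρ⁻ σ⊑ρ⁺ q
        lookup-incl {q} (inj₂ q∈P)  =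
          ≡⇒⇒ (sym (lookup-P _ q∈P)) ∘ fix ∘ σ⇒run q q∈P ∘ ≡⇒⇒ (lookup-U σ q∈P)

    -- The union of two disjoint sets of procedures.

    module Union (P₁ P₂ : ProcSet) (P₁⊆D : P₁ ⊆ declared) (P₂⊆D : P₂ ⊆ declared)
                 (P₁#P₂ : Disjoint P₁ P₂) where
      private
        U   = P₁ ∪ P₂
        U⊆D = ∪-least P₁ P₂ P₁⊆D P₂⊆D
        I₁  = interface P₁ P₁⊆D
        I₂  = interface P₂ P₂⊆D
        K   = interface U U⊆D
        m₁  = abstraction P₁ P₁⊆D
        m₂  = abstraction P₂ P₂⊆D
        m   = abstraction U U⊆D

        P₁⊆U : P₁ ⊆ U
        P₁⊆U = p⊆p∪q P₂

        P₂⊆U : P₂ ⊆ U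
        P₂⊆U = q⊆p∪q P₁ P₂

        ⊆called₁ : required I₁ ⊆ called U U⊆D
        ⊆called₁ = called-mono P₁⊆D U⊆D P₁⊆U ∘ p─q⊆p (called P₁ P₁⊆D) P₁

        ⊆called₂ : required I₂ ⊆ called U U⊆D
        ⊆called₂ = called-mono P₂⊆D U⊆D P₂⊆U ∘ p─q⊆p (called P₂ P₂⊆D) P₂

      ⊗⊆required : required (I₁ ⊗ I₂) ⊆ required K
      ⊗⊆required = ─-mono-∉ (required I₁ ∪ required I₂) U
        (∪-least (required I₁) (required I₂) ⊆called₁ ⊆called₂) id

      -- A body of the union belongs to one of the parts, so a name it calls is called from that
      -- part; being outside the union, the name is required there.
      required⊆⊗ : required K ⊆ required (I₁ ⊗ I₂)
      required⊆⊗ {q} q∈ = ─-mono-∉ (called U U⊆D) U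
        (x∈p∪q⁺ ∘ [ (λ i → inj₁ (x∈p∧x∉q⇒x∈p─q i (q∉U ∘ P₁⊆U)))
                  , (λ i → inj₂ (x∈p∧x∉q⇒x∈p─q i (q∉U ∘ P₂⊆U)))
                  ]′ ∘ x∈p∪q⁻ _ _ ∘ called-∪⁻ P₁ P₂ P₁⊆D P₂⊆D U⊆D)
        id q∈
        where q∉U = x∈p─q⇒x∉q (called U U⊆D) U q∈

      -- The witness for the product is `m` itself. Restriction moves it to the composite interface,
      -- whose required set has the same elements but is not definitionally the same.
      m⊗ : Component (I₁ ⊗ I₂)
      m⊗ = record
        { run  = run m ∘ restrict required⊆⊗
        ; mono = λ ρ⊑σ → mono m (record
            { dom  = id
            ; incl = λ p p∈ → incl ρ⊑σ p (required⊆⊗ p∈)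
            })
        }

      module _ (ρ⁻ : Env (required (I₁ ⊗ I₂))) where
        private
          ρ⁻↾ : Env (required K)
          ρ⁻↾ = restrict required⊆⊗ ρ⁻

          module Part₁ (σ : Env U) = Part P₁ U P₁⊆D U⊆D P₁⊆U ρ⁻↾ σ
            (inputs I₁ I₂ (required-⊗ˡ I₁ I₂) P₂⊆U ρ⁻ σ)
            (inputs≡lookup I₁ I₂ K (required-⊗ˡ I₁ I₂)
              (required─provided⊆ I₁ I₂ ⊆called₁ (x∈p∪q⁻ P₁ P₂)) P₂⊆U required⊆⊗ ρ⁻ σ)

          module Part₂ (σ : Env U) = Part P₂ U P₂⊆D U⊆D P₂⊆U ρ⁻↾ σ
            (inputs I₂ I₁ (required-⊗ʳ I₁ I₂) P₁⊆U ρ⁻ σ)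
            (inputs≡lookup I₂ I₁ K (required-⊗ʳ I₁ I₂)
              (required─provided⊆ I₂ I₁ ⊆called₂ (swap ∘ x∈p∪q⁻ P₁ P₂)) P₁⊆U required⊆⊗ ρ⁻ σ)

          ∈U⁻ : ∀ {p} → .(p ∈ U) → p ∈ P₁ ⊎ p ∈ P₂
          ∈U⁻ {p} p∈U = x∈p∪q⁻ P₁ P₂ (recompute (p ∈? U) p∈U)

        χ-prefixed : ∀ σ → ξ U U⊆D ρ⁻↾ σ ⊑ σ → χ m₁ m₂ ρ⁻ σ ⊑ σ
        χ-prefixed σ ξσ⊑σ = record
          { dom  = id
          ; incl = λ p p∈U →
              [ (λ i → incl (Part₁.part⊑ σ ξσ⊑σ) p i ∘ ≡⇒⇒ (χ-∈ˡ m₁ m₂ ρ⁻ σ p∈U i))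
              , (λ i → incl (Part₂.part⊑ σ ξσ⊑σ) p i ∘ ≡⇒⇒ (χ-∈ʳ m₁ m₂ P₁#P₂ ρ⁻ σ p∈U i))
              ]′ (∈U⁻ p∈U)
          }

        ξ-prefixed : ∀ σ → χ m₁ m₂ ρ⁻ σ ⊑ σ → ξ U U⊆D ρ⁻↾ (χ m₁ m₂ ρ⁻ σ) ⊑ χ m₁ m₂ ρ⁻ σ
        ξ-prefixed σ χσ⊑σ = record
          { dom  = id
          ; incl = λ p p∈U →
              [ (λ i → ≡⇒⇒ (sym (χ-∈ˡ m₁ m₂ ρ⁻ σ p∈U i)) ∘
                  Part₁.⊑part σ χσ⊑σ
                    (λ q q∈ → ≡⇒⇒ (χ-∈ˡ m₁ m₂ ρ⁻ σ (P₁⊆U q∈) q∈)) p i)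
              , (λ i → ≡⇒⇒ (sym (χ-∈ʳ m₁ m₂ P₁#P₂ ρ⁻ σ p∈U i)) ∘
                  Part₂.⊑part σ χσ⊑σ
                    (λ q q∈ → ≡⇒⇒ (χ-∈ʳ m₁ m₂ P₁#P₂ ρ⁻ σ (P₂⊆U q∈) q∈)) p i)
              ]′ (∈U⁻ p∈U)
          }

        -- The bound is `χ σ` rather than `σ` so that it serves twice: at `run m ρ⁻↾` itself it
        -- gives the missing half of the fixed-point equation, and at a fixed point of `χ` it gives
        -- minimality.
        run-⊑χ : ∀ σ → χ m₁ m₂ ρ⁻ σ ⊑ σ → run m ρ⁻↾ ⊑ χ m₁ m₂ ρ⁻ σ
        run-⊑χ σ χσ⊑σ = record
          { dom  = id
          ; incl = λ p p∈U r → ρ₀-fold U U⊆D ⊑-refl (ξ-prefixed σ χσ⊑σ) p p∈U (fix r)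
          }

        -- `run m ρ⁻↾` is `ξ` applied to `ρ₀`, so applying the monotone `ξ` to the inclusion of
        -- `ξ ρ₀` in `ρ₀` suffices.
        run-ξ-prefixed : ξ U U⊆D ρ⁻↾ (run m ρ⁻↾) ⊑ run m ρ⁻↾
        run-ξ-prefixed = record
          { dom  = id
          ; incl = λ p p∈U → ⟦⟧-mono (body p (U⊆D p∈U))
              (λ {q} _ → lookup-mono⁺ ρ⁻↾ (proj₁ (ρ₀-fixed U U⊆D ρ⁻↾)) q)
          }

        run-isLeastFixedPoint : IsLeastFixedPoint (χ m₁ m₂ ρ⁻) (run m⊗ ρ⁻)
        run-isLeastFixedPoint =
          (χrun⊑run , run-⊑χ _ χrun⊑run) ,
          λ σ χσ≈σ → ⊑-trans (run-⊑χ σ (proj₁ χσ≈σ)) (proj₁ χσ≈σ)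
          where χrun⊑run = χ-prefixed (run m ρ⁻↾) run-ξ-prefixed

      product : m₁ × m₂ ≐ m
      product = record
        { exists = m⊗ , record { composable = P₁#P₂ ; run-lfp = run-isLeastFixedPoint }
        ; equal  = λ m× m×-product → record
            { required≡ = ⊆-antisym ⊗⊆required required⊆⊗
            ; provided≡ = refl
            ; run≈      = λ {ρ} (ρ⊑ρ′ , ρ′⊑ρ) →
                -- Any product agrees with `m⊗` by uniqueness of least fixed points; monotonicity of
                -- `m` then covers both the restriction and the passage between `ρ` and `ρ′`.
                let m×⊑m⊗ , m⊗⊑m× =
                      lfp-unique (IsProduct.run-lfp m×-product ρ) (run-isLeastFixedPoint ρ)
                    ↾⊑ρ , ρ⊑↾ = restrict-≈ required⊆⊗ ⊗⊆required ρ
                in ⊑-trans m×⊑m⊗ (mono m (⊑-trans ↾⊑ρ ρ⊑ρ′)) ,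
                   ⊑-trans (mono m (⊑-trans ρ′⊑ρ ρ⊑↾)) m⊗⊑m×
            }
        }

theorem4 :
    (L : Language) (prog : Program L) →
    let open Language L
        open Program prog
        open Semantics L
        open Abstraction prog
    in
    (P₁ P₂ : ProcSet) (P₁⊆D : P₁ ⊆ declared) (P₂⊆D : P₂ ⊆ declared) →
    Disjoint P₁ P₂ →
    let m₁ = abstraction P₁ P₁⊆D
        m₂ = abstraction P₂ P₂⊆D
        m  = abstraction (P₁ ∪ P₂) (∪-least P₁ P₂ P₁⊆D P₂⊆D)
    in
    m₁ × m₂ ≐ m
theorem4 L prog = Union.product prog
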